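{- On the two-letter alphabet $\{\mathtt A,\mathtt B\}$, there exists a $1$-regular word of length $n\ge 1$ if and only if $n=4k$ for some positive integer $k$. Moreover, in that case every $1$-regular word of length $4k$ over $\{\mathtt A,\mathtt B\}$ can be obtained from the word $\mathtt A^k\mathtt B^{2k}\mathtt A^k$ by a finite sequence of operations, each of which replaces a word of the form $x\,\mathtt{AB}\,y\,\mathtt{BA}\,z$ by $x\,\mathtt{BA}\,y\,\mathtt{AB}\,z$ (for some words $x,y,z$, possibly empty), with every intermediate word being $1$-regular.
   Context: For a word $u=u_1\cdots u_m$ over an alphabet $\mathcal A$ with $b$ letters and an integer $r\ge -1$, $u$ is $r$-regular if for every $k=0,1,\dots,r$ the sum $\sum_{1\le t\le m,\ u_t=c} t^k$ is the same for all letters $c\in\mathcal A$ (a letter not occurring contributes $0$). Here $\mathcal A=\{\mathtt A,\mathtt B\}$, and $\mathtt A^k$ denotes $k$ consecutive copies of $\mathtt A$. -}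

module Defs where

open import Data.Fin using (Fin; zero; suc; toℕ; _≟_)
open import Data.Integer using (ℤ; +_) renaming (_≤_ to _≤ℤ_)
open import Data.List using (List; []; _∷_; _++_; length; lookup; map; filter; allFin; replicate)
open import Data.Nat using (ℕ; _*_; _^_)
open import Data.Nat.ListAction using (sum)
open import Data.Product using (_×_)
open import Relation.Binary.Construct.Closure.ReflexiveTransitive using (Star)
open import Relation.Binary.PropositionalEquality using (_≡_)

-- Words over an alphabet with b letters.
Word : ℕ → Set
Word b = List (Fin b)

-- Letter positions are numbered from 1, whereas Fin indices start at 0.
position : ∀ {m} → Fin m → ℕ
position i = ℕ.suc (toℕ i)

-- Σ_{1 ≤ t ≤ m, u_t = c} t^k
powerSum : ∀ {b} → ℕ → Fin b → Word b → ℕ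
powerSum k c u =
  sum (map (λ i → position i ^ k) (filter (λ i → lookup u i ≟ c) (allFin (length u))))

-- r is an integer because r = -1 (no condition at all) is permitted.
Regular : ∀ {b} → ℤ → Word b → Set
Regular {b} r u =
  ∀ (k : ℕ) → + k ≤ℤ r → ∀ (c d : Fin b) → powerSum k c u ≡ powerSum k d u

pattern A = zero
pattern B = suc zero

data Swap : Word 2 → Word 2 → Set where
  swap : ∀ (x y z : Word 2) →
         Swap (x ++ A ∷ B ∷ y ++ B ∷ A ∷ z)
              (x ++ B ∷ A ∷ y ++ A ∷ B ∷ z)

RegularSwap : Word 2 → Word 2 → Set
RegularSwap u v = Swap u v × Regular (+ 1) u × Regular (+ 1) v

-- Finite sequences of swaps in which every word is 1-regular.
RegularSwaps : Word 2 → Word 2 → Set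
RegularSwaps = Star RegularSwap

-- A^k B^{2k} A^k
baseWord : ℕ → Word 2
baseWord k = replicate k A ++ replicate (2 * k) B ++ replicate k A

{-# OPTIONS --safe #-}
-- A word over {A, B} is 1-regular iff it has as many A's as B's, say m of each,
-- and exactly half of the m² pairs consisting of an A and a B have the A first;
-- so m is even.  The reverse of an allowed operation, BA…AB ↦ AB…BA, preserves
-- this and lowers the sum of the squares of the positions of B.  A word
-- admitting no such reverse operation has the form AⁱBʲ or AⁱBʲABˡAᵐ with j ≥ 1,
-- and counting pairs shows that only AᵏB²ᵏAᵏ is 1-regular.
module Submission where

open import Data.Bool using (true; false; if_then_else_)
open import Data.Fin using (Fin; zero; suc; _≟_)
open import Data.Integer using (+_; +≤+)
open import Data.List using ([]; _∷_; _++_; length; lookup; map; filter; tabulate; replicate)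
open import Data.List.Properties using (++-assoc; ++-identityʳ; length-++; length-replicate)
open import Data.Nat using (ℕ; zero; suc; _+_; _*_; _^_; _≤_; _<_; z≤n; s≤s)
open import Data.Nat.Divisibility using (divides; ∣m+n∣m⇒∣n; >⇒∤)
open import Data.Nat.Induction using (<-wellFounded)
open import Data.Nat.ListAction using (sum)
open import Data.Nat.Primality using (prime[2]; euclidsLemma)
open import Data.Nat.Properties hiding (_≟_)
open import Data.Nat.Tactic.RingSolver using (solve-∀)
open import Data.Product using (_×_; _,_; ∃-syntax)
open import Data.Sum using (_⊎_; inj₁; inj₂; reduce)
open import Function using (id; _∘_)
open import Function.Bundles using (_⇔_; mk⇔)
open import Induction.WellFounded using (Acc; acc)
open import Level using (0ℓ)
open import Relation.Binary.Construct.Closure.ReflexiveTransitive using (ε; _◅_; _◅◅_)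
open import Relation.Binary.PropositionalEquality
open import Relation.Nullary using (contradiction; does)
open import Relation.Unary using (Pred; Decidable)
open import Defs

-- Power sums through letter counts and inversions

-- The weight is shifted along the tail, so no position counter is carried and every recursive call
-- numbers positions from 1 again.
moment : ∀ {b} → (ℕ → ℕ) → Fin b → Word b → ℕ
moment f c []      = 0
moment f c (x ∷ u) = (if does (x ≟ c) then f 1 else 0) + moment (f ∘ suc) c u

-- The index map `h` is arbitrary because the induction replaces it by `h ∘ suc`, while `P?` and `g`
-- stay fixed on the original indices.
sum-filter-tabulate : ∀ {b} {X : Set} {P : Pred X 0ℓ} (c : Fin b) (u : Word b)
  (h : Fin (length u) → X) (P? : Decidable P) (g : X → ℕ) (f : ℕ → ℕ) →
  (∀ i → does (P? (h i)) ≡ does (lookup u i ≟ c)) →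
  (∀ i → g (h i) ≡ f (position i)) →
  sum (map g (filter P? (tabulate h))) ≡ moment f c u
sum-filter-tabulate c []      h P? g f P≗ g≗ = refl
sum-filter-tabulate c (x ∷ u) h P? g f P≗ g≗
  with does (P? (h zero)) | does (x ≟ c) | P≗ zero
     | sum-filter-tabulate c u (h ∘ suc) P? g (f ∘ suc) (P≗ ∘ suc) (g≗ ∘ suc)
... | true  | true  | refl | ih = cong₂ _+_ (g≗ zero) ih
... | false | false | refl | ih = ih

powerSum≡moment : ∀ {b} k (c : Fin b) u → powerSum k c u ≡ moment (_^ k) c u
powerSum≡moment k c u =
  sum-filter-tabulate c u id (λ i → lookup u i ≟ c) _ _ (λ _ → refl) (λ _ → refl)

count : ∀ {b} → Fin b → Word b → ℕ
count = moment (λ _ → 1)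

-- For `c = B` this is the number of pairs in which an A precedes a B.
inversions : ∀ {b} → Fin b → Word b → ℕ
inversions c []      = 0
inversions c (x ∷ u) = (if does (x ≟ c) then 0 else count c u) + inversions c u

triangle : ℕ → ℕ
triangle zero    = 0
triangle (suc n) = suc n + triangle n

-- An occurrence of c at position t has t − 1 letters before it: the earlier c's
-- add up to the triangular number, the other letters to the inversions.
moment-affine : ∀ {b} (f : ℕ → ℕ) o (c : Fin b) u → (∀ t → f t ≡ o + t) →
  moment f c u ≡ o * count c u + (triangle (count c u) + inversions c u)
moment-affine f o c []      f≗ rewrite *-zeroʳ o = refl
moment-affine f o c (x ∷ u) f≗
  with does (x ≟ c)
     | moment-affine (f ∘ suc) (suc o) c u (λ t → trans (f≗ (suc t)) (+-suc o t))
... | true  | ih rewrite ih | f≗ 1 = lemma o (count c u) (triangle (count c u)) (inversions c u)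
  where
  lemma : ∀ o n t p → (o + 1) + (suc o * n + (t + p)) ≡ o * suc n + ((suc n + t) + p)
  lemma = solve-∀
... | false | ih rewrite ih = lemma o (count c u) (triangle (count c u)) (inversions c u)
  where
  lemma : ∀ o n t p → suc o * n + (t + p) ≡ o * n + (t + (n + p))
  lemma = solve-∀

powerSum₁ : ∀ {b} (c : Fin b) u → powerSum 1 c u ≡ triangle (count c u) + inversions c u
powerSum₁ c u = trans (powerSum≡moment 1 c u) (moment-affine (_^ 1) 0 c u *-identityʳ)

count-total : ∀ (w : Word 2) → count A w + count B w ≡ length w
count-total []      = refl
count-total (A ∷ w) = cong suc (count-total w)
count-total (B ∷ w) = trans (+-suc _ _) (cong suc (count-total w))

-- Each pair of an A and a B is counted exactly once, according to which letter comes first.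
inversions-total : ∀ (w : Word 2) → inversions A w + inversions B w ≡ count A w * count B w
inversions-total []      = refl
inversions-total (A ∷ w) = begin
  inversions A w + (count B w + inversions B w)
    ≡⟨ x∙yz≈y∙xz (inversions A w) (count B w) (inversions B w) ⟩
  count B w + (inversions A w + inversions B w)
    ≡⟨ cong₂ _+_ refl (inversions-total w) ⟩
  count B w + count A w * count B w ∎
  where
  open ≡-Reasoning
  open import Algebra.Properties.CommutativeSemigroup +-commutativeSemigroup using (x∙yz≈y∙xz)
inversions-total (B ∷ w) = begin
  count A w + inversions A w + inversions B w   ≡⟨ +-assoc (count A w) _ _ ⟩
  count A w + (inversions A w + inversions B w) ≡⟨ cong₂ _+_ refl (inversions-total w) ⟩
  count A w + count A w * count B w             ≡⟨ *-suc (count A w) (count B w) ⟨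
  count A w * suc (count B w)                   ∎
  where open ≡-Reasoning

-- One-regularity as balance

Balanced : Word 2 → Set
Balanced w = count A w ≡ count B w × inversions B w + inversions B w ≡ count B w * count B w

-- Order 0 gives equal counts, so the triangular terms cancel in order 1. The two inversion numbers
-- are then equal, and together they count all pairs.
regular⇒balanced : ∀ w → Regular (+ 1) w → Balanced w
regular⇒balanced w reg = a≡b , trans (cong (_+ inversions B w) (sym invA≡invB))
                                   (trans (inversions-total w) (cong (_* count B w) a≡b))
  where
  a≡b : count A w ≡ count B w
  a≡b = trans (sym (powerSum≡moment 0 A w))
          (trans (reg 0 (+≤+ z≤n) A B) (powerSum≡moment 0 B w))
  invA≡invB : inversions A w ≡ inversions B w
  invA≡invB = +-cancelˡ-≡ (triangle (count B w)) _ _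
    (trans (cong (λ n → triangle n + inversions A w) (sym a≡b))
      (trans (sym (powerSum₁ A w)) (trans (reg 1 (+≤+ ≤-refl) A B) (powerSum₁ B w))))

balanced⇒regular : ∀ w → Balanced w → Regular (+ 1) w
balanced⇒regular w (a≡b , 2inv≡b²) = regular
  where
  invA≡invB : inversions A w ≡ inversions B w
  invA≡invB = +-cancelʳ-≡ (inversions B w) _ _
    (trans (inversions-total w) (trans (cong (_* count B w) a≡b) (sym 2inv≡b²)))
  powerSumA≡B : ∀ k → k ≤ 1 → powerSum k A w ≡ powerSum k B w
  powerSumA≡B 0 _ = trans (powerSum≡moment 0 A w) (trans a≡b (sym (powerSum≡moment 0 B w)))
  powerSumA≡B 1 _ = trans (powerSum₁ A w)
    (trans (cong₂ (λ n i → triangle n + i) a≡b invA≡invB) (sym (powerSum₁ B w)))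
  powerSumA≡B (suc (suc _)) (s≤s ())
  regular : Regular (+ 1) w
  regular k (+≤+ k≤1) A A = refl
  regular k (+≤+ k≤1) A B = powerSumA≡B k k≤1
  regular k (+≤+ k≤1) B A = sym (powerSumA≡B k k≤1)
  regular k (+≤+ k≤1) B B = refl

-- Effect of the operations

-- Only one B moves, by one place. Each side adds the weight of the position that B has on the other
-- side, which avoids subtraction.
moment-transpose : ∀ f (x v : Word 2) →
  moment f B (x ++ A ∷ B ∷ v) + f (1 + length x) ≡ moment f B (x ++ B ∷ A ∷ v) + f (2 + length x)
moment-transpose f []      v = lemma (f 1) (f 2) (moment (λ t → f (2 + t)) B v)
  where
  lemma : ∀ p q m → q + m + p ≡ p + m + q
  lemma = solve-∀
moment-transpose f (c ∷ x) v = begin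
  weight + moment (f ∘ suc) B (x ++ A ∷ B ∷ v) + f (2 + length x)
    ≡⟨ +-assoc weight _ _ ⟩
  weight + (moment (f ∘ suc) B (x ++ A ∷ B ∷ v) + f (2 + length x))
    ≡⟨ cong₂ _+_ (refl {x = weight}) (moment-transpose (f ∘ suc) x v) ⟩
  weight + (moment (f ∘ suc) B (x ++ B ∷ A ∷ v) + f (3 + length x))
    ≡⟨ +-assoc weight _ _ ⟨
  weight + moment (f ∘ suc) B (x ++ B ∷ A ∷ v) + f (3 + length x) ∎
  where
  open ≡-Reasoning
  weight = if does (c ≟ B) then f 1 else 0

countA-transpose : ∀ (x v : Word 2) → count A (x ++ A ∷ B ∷ v) ≡ count A (x ++ B ∷ A ∷ v)
countA-transpose []      v = refl
countA-transpose (c ∷ x) v = cong₂ _+_ refl (countA-transpose x v)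

countB-transpose : ∀ (x v : Word 2) → count B (x ++ A ∷ B ∷ v) ≡ count B (x ++ B ∷ A ∷ v)
countB-transpose x v = +-cancelʳ-≡ 1 _ _ (moment-transpose (λ _ → 1) x v)

-- Only the transposed pair changes its relative order.
inversions-transpose : ∀ (x v : Word 2) →
  inversions B (x ++ A ∷ B ∷ v) ≡ suc (inversions B (x ++ B ∷ A ∷ v))
inversions-transpose []      v = refl
inversions-transpose (A ∷ x) v = trans (cong₂ _+_ (countB-transpose x v) (inversions-transpose x v))
                                   (+-suc (count B (x ++ B ∷ A ∷ v)) _)
inversions-transpose (B ∷ x) v = inversions-transpose x v

inner outer neither : Word 2 → Word 2 → Word 2 → Word 2
outer   x y z = x ++ A ∷ B ∷ y ++ B ∷ A ∷ z
inner   x y z = x ++ B ∷ A ∷ y ++ A ∷ B ∷ z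
neither x y z = x ++ B ∷ A ∷ y ++ B ∷ A ∷ z

-- outer and inner each differ from x BA y BA z by one transposition, of the first
-- pair (prefix x) and of the second pair (prefix x BA y) respectively.
module _ (x y z : Word 2) where

  private
    prefix : Word 2
    prefix = x ++ B ∷ A ∷ y

    reassoc : ∀ v → prefix ++ v ≡ x ++ B ∷ A ∷ y ++ v
    reassoc v = ++-assoc x (B ∷ A ∷ y) v

  countA-swap : count A (outer x y z) ≡ count A (inner x y z)
  countA-swap = trans (countA-transpose x _)
    (subst₂ (λ u v → count A u ≡ count A v) (reassoc _) (reassoc _)
      (sym (countA-transpose prefix z)))

  countB-swap : count B (outer x y z) ≡ count B (inner x y z)
  countB-swap = trans (countB-transpose x _)
    (subst₂ (λ u v → count B u ≡ count B v) (reassoc _) (reassoc _)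
      (sym (countB-transpose prefix z)))

  -- Both words have exactly one inversion more than `neither x y z`.
  inversions-swap : inversions B (outer x y z) ≡ inversions B (inner x y z)
  inversions-swap = trans (inversions-transpose x _)
    (subst₂ (λ u v → suc (inversions B u) ≡ inversions B v) (reassoc _) (reassoc _)
      (sym (inversions-transpose prefix z)))

  balanced-swap : Balanced (inner x y z) → Balanced (outer x y z)
  balanced-swap (a≡b , 2inv≡b²) =
    trans countA-swap (trans a≡b (sym countB-swap)) ,
    trans (cong (λ n → n + n) inversions-swap)
      (trans 2inv≡b² (cong (λ n → n * n) (sym countB-swap)))

moment₂-transpose : ∀ (x v : Word 2) →
  moment (_^ 2) B (x ++ A ∷ B ∷ v) ≡ moment (_^ 2) B (x ++ B ∷ A ∷ v) + (2 * length x + 3)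
moment₂-transpose x v = +-cancelʳ-≡ ((1 + length x) ^ 2) _ _
  (trans (moment-transpose (_^ 2) x v) (lemma (moment (_^ 2) B (x ++ B ∷ A ∷ v)) (length x)))
  where
  lemma : ∀ m n → m + (2 + n) * ((2 + n) * 1) ≡ m + (2 * n + 3) + (1 + n) * ((1 + n) * 1)
  lemma = solve-∀

-- The gain `2 * length x + 3` from turning BA into AB grows with the length of the prefix, so the
-- later transposition, which yields `inner`, gains more.
moment₂-swap : ∀ x y z → moment (_^ 2) B (outer x y z) < moment (_^ 2) B (inner x y z)
moment₂-swap x y z = begin-strict
  M (outer x y z)                         ≡⟨ moment₂-transpose x _ ⟩
  M (neither x y z) + (2 * length x + 3)
    <⟨ +-monoʳ-< (M (neither x y z)) (+-monoˡ-< 3 (*-monoʳ-< 2 shorter)) ⟩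
  M (neither x y z) + (2 * length p + 3)  ≡⟨ cong (λ w → M w + (2 * length p + 3)) (++-assoc x _ _) ⟨
  M (p ++ B ∷ A ∷ z) + (2 * length p + 3) ≡⟨ moment₂-transpose p z ⟨
  M (p ++ A ∷ B ∷ z)                      ≡⟨ cong M (++-assoc x _ _) ⟩
  M (inner x y z)                         ∎
  where
  open ≤-Reasoning
  M = moment (_^ 2) B
  p = x ++ B ∷ A ∷ y
  shorter : length x < length p
  shorter = subst (length x <_) (sym (length-++ x)) (m<m+n (length x) (s≤s z≤n))

-- Words in which no BA is followed by a disjoint AB

-- Block words end in ++ [] so that the lemmas on replicate n c ++ v also cover
-- the last block.

splitAB : ∀ (v : Word 2) → (∃[ y ] ∃[ z ] v ≡ y ++ A ∷ B ∷ z)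
                         ⊎ (∃[ l ] ∃[ m ] v ≡ replicate l B ++ replicate m A ++ [])
splitAB [] = inj₂ (0 , 0 , refl)
splitAB (c ∷ v) with splitAB v
splitAB (c ∷ v) | inj₁ (y , z , refl)         = inj₁ (c ∷ y , z , refl)
splitAB (A ∷ v) | inj₂ (zero , m , refl)      = inj₂ (0 , suc m , refl)
splitAB (A ∷ v) | inj₂ (suc l , m , refl)     = inj₁ ([] , _ , refl)
splitAB (B ∷ v) | inj₂ (l , m , refl)         = inj₂ (suc l , m , refl)

-- The BA found is the leftmost one, which leaves the longest suffix in which to look for a disjoint
-- AB.
splitBA : ∀ (w : Word 2) → (∃[ i ] ∃[ j ] w ≡ replicate i A ++ replicate j B ++ [])
                         ⊎ (∃[ i ] ∃[ j ] ∃[ v ] w ≡ replicate i A ++ replicate j B ++ B ∷ A ∷ v)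
splitBA [] = inj₁ (0 , 0 , refl)
splitBA (c ∷ w) with splitBA w
splitBA (A ∷ w) | inj₁ (i , j , refl)         = inj₁ (suc i , j , refl)
splitBA (A ∷ w) | inj₂ (i , j , v , refl)     = inj₂ (suc i , j , v , refl)
splitBA (B ∷ w) | inj₁ (zero , j , refl)      = inj₁ (0 , suc j , refl)
splitBA (B ∷ w) | inj₁ (suc i , j , refl)     = inj₂ (0 , 0 , _ , refl)
splitBA (B ∷ w) | inj₂ (zero , j , v , refl)  = inj₂ (0 , suc j , v , refl)
splitBA (B ∷ w) | inj₂ (suc i , j , v , refl) = inj₂ (0 , 0 , _ , refl)

countA-Aⁿ++ : ∀ n (v : Word 2) → count A (replicate n A ++ v) ≡ n + count A v
countA-Aⁿ++ zero    v = refl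
countA-Aⁿ++ (suc n) v = cong suc (countA-Aⁿ++ n v)

countA-Bⁿ++ : ∀ n (v : Word 2) → count A (replicate n B ++ v) ≡ count A v
countA-Bⁿ++ zero    v = refl
countA-Bⁿ++ (suc n) v = countA-Bⁿ++ n v

countB-Aⁿ++ : ∀ n (v : Word 2) → count B (replicate n A ++ v) ≡ count B v
countB-Aⁿ++ zero    v = refl
countB-Aⁿ++ (suc n) v = countB-Aⁿ++ n v

countB-Bⁿ++ : ∀ n (v : Word 2) → count B (replicate n B ++ v) ≡ n + count B v
countB-Bⁿ++ zero    v = refl
countB-Bⁿ++ (suc n) v = cong suc (countB-Bⁿ++ n v)

inversions-Aⁿ++ : ∀ n (v : Word 2) →
  inversions B (replicate n A ++ v) ≡ n * count B v + inversions B v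
inversions-Aⁿ++ zero    v = refl
inversions-Aⁿ++ (suc n) v = trans (cong₂ _+_ (countB-Aⁿ++ n v) (inversions-Aⁿ++ n v))
                              (sym (+-assoc (count B v) _ _))

inversions-Bⁿ++ : ∀ n (v : Word 2) → inversions B (replicate n B ++ v) ≡ inversions B v
inversions-Bⁿ++ zero    v = refl
inversions-Bⁿ++ (suc n) v = inversions-Bⁿ++ n v

replicate-∷ : ∀ {X : Set} n (c : X) v → replicate n c ++ c ∷ v ≡ c ∷ replicate n c ++ v
replicate-∷ zero    c v = refl
replicate-∷ (suc n) c v = cong (c ∷_) (replicate-∷ n c v)

-- Balance of the block words

baseWord-++[] : ∀ k → baseWord k ≡ replicate k A ++ replicate (2 * k) B ++ replicate k A ++ []
baseWord-++[] k = cong (λ v → replicate k A ++ replicate (2 * k) B ++ v) (sym (++-identityʳ _))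

baseWord-balanced : ∀ k → Balanced (baseWord k)
baseWord-balanced k
  rewrite baseWord-++[] k
        | countA-Aⁿ++ k (replicate (2 * k) B ++ replicate k A ++ [])
        | countA-Bⁿ++ (2 * k) (replicate k A ++ [])
        | countA-Aⁿ++ k []
        | countB-Aⁿ++ k (replicate (2 * k) B ++ replicate k A ++ [])
        | inversions-Aⁿ++ k (replicate (2 * k) B ++ replicate k A ++ [])
        | inversions-Bⁿ++ (2 * k) (replicate k A ++ [])
        | countB-Bⁿ++ (2 * k) (replicate k A ++ [])
        | countB-Aⁿ++ k []
        | inversions-Aⁿ++ k []
  = sym (+-identityʳ (2 * k)) , lemma k
  where
  lemma : ∀ k → (k * (2 * k + 0) + (k * 0 + 0)) + (k * (2 * k + 0) + (k * 0 + 0))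
              ≡ (2 * k + 0) * (2 * k + 0)
  lemma = solve-∀

-- Every pair has its A first, and equal counts force `i = j`, so balance reads
-- `i * i + i * i ≡ i * i`.
balanced-AⁱBʲ⇒countB≡0 : ∀ i j → let w = replicate i A ++ replicate j B ++ [] in
  Balanced w → count B w ≡ 0
balanced-AⁱBʲ⇒countB≡0 i j bal
  rewrite countA-Aⁿ++ i (replicate j B ++ [])
        | countA-Bⁿ++ j []
        | countB-Aⁿ++ i (replicate j B ++ [])
        | inversions-Aⁿ++ i (replicate j B ++ [])
        | countB-Bⁿ++ j []
        | inversions-Bⁿ++ j []
        | +-identityʳ i | +-identityʳ j | +-identityʳ (i * j)
  with bal
... | refl , 2inv≡b² = reduce (m*n≡0⇒m≡0∨n≡0 i (+-cancelʳ-≡ (i * i) (i * i) 0 2inv≡b²))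

-- With `n = suc k`, the first i A's precede all `2 * n` B's and the next A precedes l of them, so
-- balance gives `i * (2 * n) + l ≡ n * (2 * n)`. Hence `2 * n` divides l, which is smaller; so l is
-- 0 and `i = n`.
balanced-AⁱBʲABˡAᵐ⇒baseWord : ∀ k i j l m →
  let w = replicate i A ++ replicate j B ++ B ∷ A ∷ replicate l B ++ replicate m A ++ [] in
  count B w ≡ 2 * suc k → Balanced w → w ≡ baseWord (suc k)
balanced-AⁱBʲABˡAᵐ⇒baseWord k i j l m b≡2k bal
  rewrite countA-Aⁿ++ i (replicate j B ++ B ∷ A ∷ replicate l B ++ replicate m A ++ [])
        | countA-Bⁿ++ j (B ∷ A ∷ replicate l B ++ replicate m A ++ [])
        | countA-Bⁿ++ l (replicate m A ++ [])
        | countA-Aⁿ++ m []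
        | inversions-Aⁿ++ i (replicate j B ++ B ∷ A ∷ replicate l B ++ replicate m A ++ [])
        | countB-Aⁿ++ i (replicate j B ++ B ∷ A ∷ replicate l B ++ replicate m A ++ [])
        | inversions-Bⁿ++ j (B ∷ A ∷ replicate l B ++ replicate m A ++ [])
        | inversions-Bⁿ++ l (replicate m A ++ [])
        | inversions-Aⁿ++ m []
        | countB-Bⁿ++ j (B ∷ A ∷ replicate l B ++ replicate m A ++ [])
        | countB-Bⁿ++ l (replicate m A ++ [])
        | countB-Aⁿ++ m []
        -- The second `+-identityʳ l` removes an `l + 0` that appears only once `m * 0` has
        -- vanished.
        | +-identityʳ l | +-identityʳ m | *-zeroʳ m | +-identityʳ l
        | b≡2k
  with i+1+m≡2k , 2inv≡4k² ← bal
  = word≡ l i+1+m≡2k b≡2k l<2k inv≡2k²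
  where
  n = suc k
  l<2k : l < 2 * n
  l<2k = subst (l <_) b≡2k (m≤n+m (suc l) j)
  inv≡2k² : i * (2 * n) + l ≡ n * (2 * n)
  inv≡2k² = *-cancelˡ-≡ _ _ 2 (trans (lemma (i * (2 * n) + l)) (trans 2inv≡4k² (lemma′ n)))
    where
    lemma : ∀ p → 2 * p ≡ p + p
    lemma = solve-∀
    lemma′ : ∀ n → (2 * n) * (2 * n) ≡ 2 * (n * (2 * n))
    lemma′ = solve-∀
  word≡ : ∀ l → i + suc m ≡ 2 * n → j + suc l ≡ 2 * n → l < 2 * n →
    i * (2 * n) + l ≡ n * (2 * n) →
    replicate i A ++ replicate j B ++ B ∷ A ∷ replicate l B ++ replicate m A ++ [] ≡ baseWord n
  word≡ l@(suc _) _ _ l<2k inv≡2k² = contradiction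
    (∣m+n∣m⇒∣n (divides n inv≡2k²) (divides i refl)) (>⇒∤ l<2k)
  word≡ zero i+1+m≡2k j+1≡2k _ inv≡2k² = begin
    replicate i A ++ replicate j B ++ B ∷ replicate (suc m) A ++ []
      ≡⟨ cong (replicate i A ++_) (replicate-∷ j B _) ⟩
    replicate i A ++ replicate (suc j) B ++ replicate (suc m) A ++ []
      ≡⟨ cong (λ p → replicate p A ++ replicate (suc j) B ++ replicate (suc m) A ++ []) i≡k ⟩
    replicate n A ++ replicate (suc j) B ++ replicate (suc m) A ++ []
      ≡⟨ cong₂ (λ p q → replicate n A ++ replicate p B ++ replicate q A ++ [])
           (trans (sym (+-comm j 1)) j+1≡2k) 1+m≡k ⟩
    replicate n A ++ replicate (2 * n) B ++ replicate n A ++ []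
      ≡⟨ baseWord-++[] n ⟨
    baseWord n ∎
    where
    open ≡-Reasoning
    i≡k : i ≡ n
    i≡k = *-cancelʳ-≡ i n (2 * n) (trans (sym (+-identityʳ _)) inv≡2k²)
    1+m≡k : suc m ≡ n
    1+m≡k = +-cancelˡ-≡ n _ _
      (trans (cong (_+ suc m) (sym i≡k)) (trans i+1+m≡2k (cong₂ _+_ (refl {x = n}) (+-identityʳ n))))

-- Descent to the base word and possible lengths

count-balanced : ∀ w → Balanced w → count B w + count B w ≡ length w
count-balanced w (a≡b , _) = trans (cong (_+ count B w) (sym a≡b)) (count-total w)

findInner : ∀ w → (∃[ x ] ∃[ y ] ∃[ z ] w ≡ inner x y z)
  ⊎ (∃[ i ] ∃[ j ] w ≡ replicate i A ++ replicate j B ++ [])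
  ⊎ (∃[ i ] ∃[ j ] ∃[ l ] ∃[ m ]
       w ≡ replicate i A ++ replicate j B ++ B ∷ A ∷ replicate l B ++ replicate m A ++ [])
findInner w with splitBA w
... | inj₁ AⁱBʲ = inj₂ (inj₁ AⁱBʲ)
... | inj₂ (i , j , v , refl) with splitAB v
...   | inj₁ (y , z , refl) = inj₁ (replicate i A ++ replicate j B , y , z ,
                                    sym (++-assoc (replicate i A) (replicate j B) _))
...   | inj₂ (l , m , refl) = inj₂ (inj₂ (i , j , l , m , refl))

-- Well-founded induction on the sum of the squares of the positions of B. Each reverse operation
-- lowers it, so the path is built from its last swap backwards.
reachable : ∀ k w → Acc _<_ (moment (_^ 2) B w) → count B w ≡ 2 * suc k → Balanced w →
  RegularSwaps (baseWord (suc k)) w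
reachable k w (acc rec) b≡2k bal with findInner w
... | inj₁ (x , y , z , refl) =
  reachable k (outer x y z) (rec (moment₂-swap x y z)) (trans (countB-swap x y z) b≡2k) bal′
    ◅◅ (swap x y z , balanced⇒regular (outer x y z) bal′ , balanced⇒regular w bal) ◅ ε
  where
  bal′ : Balanced (outer x y z)
  bal′ = balanced-swap x y z bal
... | inj₂ (inj₁ (i , j , refl)) =
  -- Here w would contain no B, whereas `2 * suc k` is positive.
  contradiction (trans (sym (balanced-AⁱBʲ⇒countB≡0 i j bal)) b≡2k) λ ()
... | inj₂ (inj₂ (i , j , l , m , refl)) =
  subst (RegularSwaps _) (sym (balanced-AⁱBʲABˡAᵐ⇒baseWord k i j l m b≡2k bal)) ε

n+n≡n*2 : ∀ n → n + n ≡ n * 2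
n+n≡n*2 = solve-∀

-- The square of `count B w` is even, so `count B w` is even because 2 is prime, and the length is
-- twice that count.
balanced-length : ∀ w → 1 ≤ length w → Balanced w → ∃[ k ] (1 ≤ k × length w ≡ 4 * k)
balanced-length w 1≤n bal@(_ , 2inv≡b²)
  with divides q b≡q*2 ← reduce (euclidsLemma (count B w) (count B w) prime[2]
         (divides (inversions B w) (trans (sym 2inv≡b²) (n+n≡n*2 (inversions B w)))))
  = q , 1≤q q n≡4q , n≡4q
  where
  lemma : ∀ q → q * 2 + q * 2 ≡ 4 * q
  lemma = solve-∀
  n≡4q : length w ≡ 4 * q
  n≡4q = trans (sym (count-balanced w bal)) (trans (cong₂ _+_ b≡q*2 b≡q*2) (lemma q))
  1≤q : ∀ q → length w ≡ 4 * q → 1 ≤ q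
  1≤q zero    n≡0 = contradiction (subst (1 ≤_) n≡0 1≤n) λ ()
  1≤q (suc _) _   = s≤s z≤n

length-baseWord : ∀ k → length (baseWord k) ≡ 4 * k
length-baseWord k = begin
  length (baseWord k)
    ≡⟨ length-++ (replicate k A) ⟩
  length (replicate k A) + length (replicate (2 * k) B ++ replicate k A)
    ≡⟨ cong₂ _+_ (length-replicate k) (length-++ (replicate (2 * k) B)) ⟩
  k + (length (replicate (2 * k) B) + length (replicate k A))
    ≡⟨ cong₂ (λ p q → k + (p + q)) (length-replicate (2 * k)) (length-replicate k) ⟩
  k + (2 * k + k)
    ≡⟨ lemma k ⟩
  4 * k ∎
  where
  open ≡-Reasoning
  lemma : ∀ k → k + (2 * k + k) ≡ 4 * k
  lemma = solve-∀

mainTheorem7 : (∀ (n : ℕ) → 1 ≤ n →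
    (∃[ w ] (length w ≡ n × Regular {2} (+ 1) w)) ⇔ (∃[ k ] (1 ≤ k × n ≡ 4 * k)))
    × (∀ (k : ℕ) → 1 ≤ k → ∀ (w : Word 2) → length w ≡ 4 * k → Regular (+ 1) w →
    RegularSwaps (baseWord k) w)
mainTheorem7 = existence , reachability
  where
  existence : ∀ n → 1 ≤ n →
    (∃[ w ] (length w ≡ n × Regular {2} (+ 1) w)) ⇔ (∃[ k ] (1 ≤ k × n ≡ 4 * k))
  existence n 1≤n = mk⇔
    (λ { (w , refl , reg) → balanced-length w 1≤n (regular⇒balanced w reg) })
    (λ { (k , _ , refl) →
      baseWord k , length-baseWord k , balanced⇒regular (baseWord k) (baseWord-balanced k) })
  reachability : ∀ k → 1 ≤ k → ∀ w → length w ≡ 4 * k → Regular (+ 1) w →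
    RegularSwaps (baseWord k) w
  reachability (suc k) _ w len reg = reachable k w (<-wellFounded _) b≡2k bal
    where
    bal : Balanced w
    bal = regular⇒balanced w reg
    b≡2k : count B w ≡ 2 * suc k
    -- Both sides are doubled: `length w` is twice `count B w`, and `4 * suc k` regroups as
    -- `2 * (2 * suc k)`.
    b≡2k = *-cancelˡ-≡ _ _ 2 (trans (cong₂ _+_ (refl {x = count B w}) (+-identityʳ _))
      (trans (count-balanced w bal) (trans len (*-assoc 2 2 (suc k)))))
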